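{- For all integers $p,q\geq 3$, $\mathrm{mbt}(K_p\Box C_q)=\Delta(K_p\Box C_q)+1$, where $K_p$ is the complete graph on $p$ vertices and $C_q$ is the cycle on $q$ vertices.
   Context: A book embedding of a graph $G$ consists of a linear ordering of $V(G)$ (the vertices placed on the spine) together with an assignment of each edge to one of a set of pages such that no two edges on the same page cross, i.e. there are no two edges $uv$, $xy$ on the same page with $u<x<v<y$ in the ordering. A book embedding is matching if on every page each vertex is incident with at most one edge of that page (the edges of each page form a matching). The matching book thickness $\mathrm{mbt}(G)$ is the minimum number of pages over all matching book embeddings of $G$. $\Delta(G)$ denotes the maximum degree of $G$. The Cartesian product $G\Box B$ has vertex set $V(G)\times V(B)$, with $(u_1,v_1)$ adjacent to $(u_2,v_2)$ iff either $u_1=u_2$ and $v_1v_2\in E(B)$, or $v_1=v_2$ and $u_1u_2\in E(G)$. -}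

module Defs where

open import Data.Fin.Base using (Fin; toℕ)
open import Data.Fin.Properties using (*↔×; inj⇒≟) renaming (_≟_ to _≟F_)
open import Data.List.Base using (List; map; filter; length; allFin)
open import Data.List.Extrema.Nat using (max)
open import Data.Nat.Base using (ℕ; suc; _*_; _≤_; s≤s)
open import Data.Nat.Properties using (1+n≢n) renaming (_≟_ to _≟ℕ_)
open import Data.Product.Base using (Σ; _×_; _,_)
open import Data.Product.Function.NonDependent.Propositional using (_×-↔_)
open import Data.Sum.Base as Sum using (_⊎_; inj₁; inj₂; [_,_]′)
open import Function.Bundles using (_↔_; Inverse)
open import Function.Construct.Composition using (_↔-∘_)
open import Function.Construct.Identity using (↔-id)
open import Function.Construct.Symmetry using (↔-sym)
open import Function.Properties.Inverse using (↔⇒↣)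
open import Level using (0ℓ)
open import Relation.Binary.Core using (Rel)
open import Relation.Binary.Definitions using (Decidable; DecidableEquality; Symmetric; Irreflexive)
open import Relation.Binary.PropositionalEquality.Core using (_≡_; _≢_; refl; sym; ≢-sym)
open import Relation.Binary.Structures using (IsStrictTotalOrder)
open import Relation.Nullary.Decidable.Core using (_×-dec_; _⊎-dec_; ¬?)
open import Relation.Nullary.Negation.Core using (¬_)

-- Finite simple graphs.
record Graph : Set₁ where
  infix 4 _~_ _~?_ _≟_
  field
    V      : Set
    order  : ℕ
    finite : V ↔ Fin order
    _~_    : Rel V 0ℓ
    _~?_   : Decidable _~_
    ~-sym  : Symmetric _~_
    ~-irr  : Irreflexive _≡_ _~_

  _≟_ : DecidableEquality V
  _≟_ = inj⇒≟ (↔⇒↣ finite)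

  vertices : List V
  vertices = map (Inverse.from finite) (allFin order)

  degree : V → ℕ
  degree v = length (filter (v ~?_) vertices)

Δ : Graph → ℕ
Δ G = max 0 (map degree vertices)
  where open Graph G

K : ℕ → Graph
K p = record
  { V      = Fin p
  ; order  = p
  ; finite = ↔-id (Fin p)
  ; _~_    = _≢_
  ; _~?_   = λ u v → ¬? (u ≟F v)
  ; ~-sym  = ≢-sym
  ; ~-irr  = λ u≡v u≢v → u≢v u≡v
  }

module _ {q : ℕ} where

  -- j is the cyclic successor of i in 0, 1, …, q-1.
  Next : Rel (Fin q) 0ℓ
  Next i j = suc (toℕ i) ≡ toℕ j ⊎ (suc (toℕ i) ≡ q × toℕ j ≡ 0)

  next? : Decidable Next
  next? i j = (suc (toℕ i) ≟ℕ toℕ j)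
        ⊎-dec ((suc (toℕ i) ≟ℕ q) ×-dec (toℕ j ≟ℕ 0))

  next-irr : 3 ≤ q → ∀ {i} → ¬ Next i i
  next-irr _ (inj₁ 1+i≡i) = 1+n≢n 1+i≡i
  next-irr (s≤s (s≤s _)) {i} (inj₂ (1+i≡q , i≡0)) with toℕ i
  next-irr (s≤s (s≤s _)) {i} (inj₂ (() , refl)) | .0

C : (q : ℕ) → 3 ≤ q → Graph
C q 3≤q = record
  { V      = Fin q
  ; order  = q
  ; finite = ↔-id (Fin q)
  ; _~_    = λ i j → Next i j ⊎ Next j i
  ; _~?_   = λ i j → next? i j ⊎-dec next? j i
  ; ~-sym  = Sum.swap
  ; ~-irr  = λ { refl → [ next-irr 3≤q , next-irr 3≤q ]′ }
  }

infixr 7 _□_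

_□_ : Graph → Graph → Graph
G □ B = record
  { V      = G.V × B.V
  ; order  = G.order * B.order
  ; finite = ↔-sym *↔× ↔-∘ (G.finite ×-↔ B.finite)
  ; _~_    = λ { (u₁ , v₁) (u₂ , v₂) →
               (u₁ ≡ u₂ × v₁ B.~ v₂) ⊎ (v₁ ≡ v₂ × u₁ G.~ u₂) }
  ; _~?_   = λ { (u₁ , v₁) (u₂ , v₂) →
               ((u₁ G.≟ u₂) ×-dec (v₁ B.~? v₂)) ⊎-dec ((v₁ B.≟ v₂) ×-dec (u₁ G.~? u₂)) }
  ; ~-sym  = Sum.map (λ { (e , a) → sym e , B.~-sym a }) (λ { (e , a) → sym e , G.~-sym a })
  ; ~-irr  = λ { refl → [ (λ { (_ , a) → B.~-irr refl a }) , (λ { (_ , a) → G.~-irr refl a }) ]′ }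
  }
  where
  module G = Graph G
  module B = Graph B

record BookEmbedding (G : Graph) (k : ℕ) : Set₁ where
  open Graph G
  infix 4 _<_
  field
    _<_                : Rel V 0ℓ
    isStrictTotalOrder : IsStrictTotalOrder _≡_ _<_
    page               : ∀ {u v} → u ~ v → Fin k
    -- Makes page a function of the unordered pair {u , v}: used twice, it also
    -- gives independence of the adjacency proof.
    page-unordered     : ∀ {u v} (e : u ~ v) (e′ : v ~ u) → page e ≡ page e′
    noncrossing        : ∀ {u v x y} (e : u ~ v) (f : x ~ y) → page e ≡ page f →
                         ¬ (u < x × x < v × v < y)

IsMatching : ∀ {G k} → BookEmbedding G k → Set
IsMatching {G} E = ∀ {u v w} (e : u ~ v) (f : u ~ w) → page e ≡ page f → v ≡ w
  where
  open Graph G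
  open BookEmbedding E

MatchingBookEmbedding : Graph → ℕ → Set₁
MatchingBookEmbedding G k = Σ (BookEmbedding G k) IsMatching

-- mbt G ≡ k, with the minimum expressed as a relation.  Pages may be empty, which
-- does not affect the minimum.
mbt_≔_ : Graph → ℕ → Set₁
mbt G ≔ k = MatchingBookEmbedding G k × (∀ j → MatchingBookEmbedding G j → k ≤ j)

infix 4 mbt_≔_

{-# OPTIONS --safe #-}

-- K_p □ C_q is (p+1)-regular.
--
-- Lower bound.  With only p+1 pages every page would be a noncrossing perfect
-- matching.  The vertices strictly under an edge are then matched among
-- themselves, so their number is even, and the parity of the position on the
-- spine is a proper 2-colouring.  But K_p contains a triangle.
--
-- Upper bound.  Put the copies of K_p one after another on the spine, every
-- second one reversed, so that the links between consecutive copies are nested;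
-- alternate these links between pages p+1 and p.  A copy of K_p needs p further
-- pages, edge ij going to page i+j mod p.  If q is even, the closing links between
-- the last copy and copy 0 are nested as well and go to page p.  If q is odd they
-- cross pairwise and are put on p different pages, number i at vertex i: in the two
-- outer copies K_p is drawn as part of K_{p+1} with edge ij on page i+j+1 mod p+1,
-- the additional vertex p being the common far end of the closing links.

module Submission where

open import Algebra.Properties.CommutativeMonoid.Sum using ()
open import Data.Bool.Base using (if_then_else_)
open import Data.Fin.Base using (Fin; zero; suc; toℕ; fromℕ; fromℕ<; inject₁; punchIn; punchOut; _≤_; _<_)
open import Data.Fin.Permutation using (Permutation′; permutation)
open import Data.Fin.Properties
  using (any?; injective⇒≤; punchOut-injective; toℕ-injective; toℕ<n; toℕ-fromℕ; toℕ-fromℕ<;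
         toℕ-inject₁; fromℕ<-cong; fromℕ<-injective; punchIn-injective; punchInᵢ≢i;
         punchIn-punchOut; <-cmp; ≤-total; ≤-refl)
  renaming (_≟_ to _≟F_)
open import Data.List.Base using (List; lookup; length; filter; map; allFin; []; _∷_)
open import Data.List.Extrema.Nat using (max≤v⁺; v≤max⁺)
open import Data.List.Membership.Propositional using (_∈_; lose)
open import Data.List.Membership.Propositional.Properties
  using (∈-lookup; ∈-filter⁻; ∈-filter⁺; ∈-map⁺; ∈-map⁻; ∈-allFin)
open import Data.List.Membership.Propositional.Properties.WithK using (unique∧set⇒bag)
open import Data.List.Properties using (length-map; length-tabulate)
open import Data.List.Relation.Binary.BagAndSetEquality using (∼bag⇒↭)
open import Data.List.Relation.Binary.Permutation.Propositional.Properties using (↭-length)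
open import Data.List.Relation.Unary.All as All using ([]; _∷_)
import Data.List.Relation.Unary.All.Properties as All
open import Data.List.Relation.Unary.AllPairs using (_∷_)
open import Data.List.Relation.Unary.Any using (here; there)
open import Data.List.Relation.Unary.Unique.Propositional using (Unique)
import Data.List.Relation.Unary.Unique.Propositional.Properties as Unique
open import Data.Nat.Base as ℕ using (ℕ; zero; suc; _+_; _*_; z≤n; s≤s; NonZero)
open import Data.Nat.DivMod using (_%_; _/_; m≡m%n+[m/n]*n; m%n<n; [m+n]%n≡m%n; m<n⇒m%n≡m)
import Data.Nat.Properties as ℕ
open import Data.Parity.Base as ℙ using (Parity; 0ℙ; 1ℙ; _⁻¹)
open import Data.Parity.Properties as ℙ using (p≢p⁻¹; ⁻¹-involutive; p+p≡0ℙ; +-0-commutativeMonoid; suc-homo-⁻¹)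
open import Data.Product.Base using (Σ; ∃; _×_; _,_; proj₁; proj₂)
open import Data.Sum.Base using (_⊎_; inj₁; inj₂; [_,_]′)
open import Function.Base using (_∘_)
open import Function.Bundles using (Inverse; _⇔_; mk⇔; Equivalence)
open import Function.Definitions using (Injective)
open import Relation.Binary.Definitions using (Transitive; Irreflexive; Trichotomous; Tri; tri<; tri≈; tri>)
open import Relation.Binary.PropositionalEquality
  using (_≡_; _≢_; refl; sym; trans; cong; cong₂; subst; ≢-sym; isEquivalence; module ≡-Reasoning)
open import Relation.Binary.Structures using (IsStrictTotalOrder)
open import Relation.Nullary.Decidable.Core using (Dec; yes; no; does; _×-dec_)
open import Relation.Nullary.Negation.Core using (¬_; contradiction)
open import Relation.Unary using (Decidable)

open import Defs

open Algebra.Properties.CommutativeMonoid.Sum +-0-commutativeMonoid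
  using (sum; sum-cong-≗; sum-replicate-zero; ∑-distrib-+; sum-permute)

-- Counting modulo 2

𝟙 : ∀ {A : Set} → Dec A → Parity
𝟙 a? = if does a? then 1ℙ else 0ℙ

𝟙-true : ∀ {A : Set} (a? : Dec A) → A → 𝟙 a? ≡ 1ℙ
𝟙-true (yes _) _ = refl
𝟙-true (no ¬a) a = contradiction a ¬a

𝟙-false : ∀ {A : Set} (a? : Dec A) → ¬ A → 𝟙 a? ≡ 0ℙ
𝟙-false (yes a) ¬a = contradiction a ¬a
𝟙-false (no _)  _  = refl

𝟙-cong : ∀ {A B : Set} (a? : Dec A) (b? : Dec B) → (A → B) → (B → A) → 𝟙 a? ≡ 𝟙 b?
𝟙-cong (yes a) b? f g = sym (𝟙-true b? (f a))
𝟙-cong (no ¬a) b? f g = sym (𝟙-false b? (¬a ∘ g))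

sum-singleton : ∀ {n} (k : Fin n) → sum (λ i → 𝟙 (i ≟F k)) ≡ 1ℙ
sum-singleton {suc n} zero    = cong (1ℙ ℙ.+_) (sum-replicate-zero n)
sum-singleton {suc n} (suc k) = sum-singleton k

-- Pigeonhole: if `c` were missed, `punchOut` would inject `Fin m` into a set with one element less
-- than `Fin n`.
injective∧≥⇒surjective : ∀ {m n} {f : Fin m → Fin n} → Injective _≡_ _≡_ f → n ℕ.≤ m →
                         ∀ c → ∃ λ i → f i ≡ c
injective∧≥⇒surjective {n = suc n} {f} f-inj n≤m c with any? (λ i → f i ≟F c)
... | yes hit = hit
... | no ¬hit = contradiction (ℕ.≤-trans n≤m (injective⇒≤ punched-inj)) ℕ.1+n≰n
  where
  c≢f : ∀ i → c ≢ f i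
  c≢f i c≡fi = ¬hit (i , sym c≡fi)
  punched-inj : Injective _≡_ _≡_ (λ i → punchOut (c≢f i))
  punched-inj eq = f-inj (punchOut-injective (c≢f _) (c≢f _) eq)

lookup-injective : ∀ {A : Set} {xs : List A} → Unique xs → Injective _≡_ _≡_ (lookup xs)
lookup-injective (x∉ ∷ u) {zero}  {zero}  eq = refl
lookup-injective (x∉ ∷ u) {zero}  {suc j} eq = contradiction eq (All.lookup x∉ (∈-lookup j))
lookup-injective (x∉ ∷ u) {suc i} {zero}  eq = contradiction (sym eq) (All.lookup x∉ (∈-lookup i))
lookup-injective (x∉ ∷ u) {suc i} {suc j} eq = cong suc (lookup-injective u eq)

-- The lower bound

module _ (G : Graph) where

  open Graph G

  private
    open module F = Inverse finite using (to; from)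

  from-injective : ∀ {i j} → from i ≡ from j → i ≡ j
  from-injective {i} {j} eq = trans (sym (F.strictlyInverseˡ i)) (trans (cong to eq) (F.strictlyInverseˡ j))

  vertices-unique : Unique vertices
  vertices-unique = Unique.map⁺ from-injective (Unique.allFin⁺ order)

  neighbours-unique : ∀ v → Unique (filter (v ~?_) vertices)
  neighbours-unique v = Unique.filter⁺ (v ~?_) vertices-unique

  parityOf : (V → Parity) → Parity
  parityOf f = sum (λ i → f (from i))

  parityOf-singleton : ∀ v → parityOf (λ w → 𝟙 (w ≟ v)) ≡ 1ℙ
  parityOf-singleton v = trans
    (sum-cong-≗ λ i → 𝟙-cong (from i ≟ v) (i ≟F to v)
      (λ eq → trans (sym (F.strictlyInverseˡ i)) (cong to eq))
      (λ eq → trans (cong from eq) (F.strictlyInverseʳ v)))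
    (sum-singleton (to v))

  module _ (f : V → V) (f-involutive : ∀ v → f (f v) ≡ v) where

    private
      π : Permutation′ order
      π = permutation (to ∘ f ∘ from) (to ∘ f ∘ from) inv inv
        where
        inv : ∀ i → to (f (from (to (f (from i))))) ≡ i
        inv i = trans (cong (to ∘ f) (F.strictlyInverseʳ _))
          (trans (cong to (f-involutive _)) (F.strictlyInverseˡ i))

    -- Reindexing by the permutation `π` shows that `g` and `g ∘ f` have equal sums, and these
    -- cancel modulo 2.
    parityOf-involution : ∀ g → parityOf (λ w → g w ℙ.+ g (f w)) ≡ 0ℙ
    parityOf-involution g = begin
      parityOf (λ w → g w ℙ.+ g (f w))
        ≡⟨ ∑-distrib-+ (g ∘ from) (g ∘ f ∘ from) ⟩
      parityOf g ℙ.+ parityOf (g ∘ f)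
        ≡⟨ cong (parityOf g ℙ.+_) (sum-cong-≗ λ i → cong g (sym (F.strictlyInverseʳ (f (from i))))) ⟩
      parityOf g ℙ.+ sum (g ∘ from ∘ to ∘ f ∘ from)
        ≡⟨ cong (parityOf g ℙ.+_) (sym (sum-permute (g ∘ from) π)) ⟩
      parityOf g ℙ.+ parityOf g
        ≡⟨ p+p≡0ℙ (parityOf g) ⟩
      0ℙ ∎
      where open ≡-Reasoning

  module _ {d} (E : BookEmbedding G d) (matching : IsMatching {G} E) (d≤degree : ∀ v → d ℕ.≤ degree v) where

    open BookEmbedding E renaming (_<_ to _≺_)
    open IsStrictTotalOrder isStrictTotalOrder
      using (compare; _<?_; irrefl) renaming (trans to <-trans)

    -- Opaque, since otherwise partner unfolds to the search for the edge in every later goal.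
    opaque
      edge-on-page : ∀ c v → Σ V λ w → Σ (v ~ w) λ e → page e ≡ c
      edge-on-page c v =
        -- The matching condition puts the edges at `v` on distinct pages; as there are at least `d`
        -- of them, every page occurs at `v`.
        let i , eq = injective∧≥⇒surjective pageAt-injective (d≤degree v) c
        in  lookup nbrs i , adjacent i , eq
        where
        nbrs : List V
        nbrs = filter (v ~?_) vertices
        adjacent : ∀ i → v ~ lookup nbrs i
        adjacent i = proj₂ (∈-filter⁻ (v ~?_) {xs = vertices} (∈-lookup i))
        pageAt-injective : Injective _≡_ _≡_ (λ i → page (adjacent i))
        pageAt-injective eq = lookup-injective (neighbours-unique v) (matching _ _ eq)

    module _ (c : Fin d) where

      partner : V → V
      partner v = proj₁ (edge-on-page c v)

      partner-edge : ∀ v → v ~ partner v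
      partner-edge v = proj₁ (proj₂ (edge-on-page c v))

      partner-page : ∀ v → page (partner-edge v) ≡ c
      partner-page v = proj₂ (proj₂ (edge-on-page c v))

      partner-unique : ∀ {v w} (e : v ~ w) → page e ≡ c → partner v ≡ w
      partner-unique {v} e eq = matching (partner-edge v) e (trans (partner-page v) (sym eq))

      partner-page′ : ∀ v → page (~-sym (partner-edge v)) ≡ c
      partner-page′ v = trans (sym (page-unordered (partner-edge v) _)) (partner-page v)

      partner-involutive : ∀ v → partner (partner v) ≡ v
      partner-involutive v = partner-unique (~-sym (partner-edge v)) (partner-page′ v)

    Between : V → V → V → Set
    Between u v w = u ≺ w × w ≺ v

    between? : ∀ u v → Decidable (Between u v)
    between? u v w = (u <? w) ×-dec (w <? v)

    -- If the partner of `w` lay outside the interval, its edge would cross `e`; if it were `u` or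
    -- `v`, then `w` would be the other end of `e`.
    partner-between : ∀ {u v w} (e : u ~ v) → Between u v w → Between u v (partner (page e) w)
    partner-between {u} {v} {w} e (u<w , w<v) with compare u (partner (page e) w)
    ... | tri≈ _ u≡w′ _ = contradiction w<v (irrefl (trans (sym (partner-involutive (page e) w))
          (trans (cong (partner (page e)) (sym u≡w′)) (partner-unique (page e) e refl))))
    ... | tri> _ _ w′<u = contradiction (w′<u , u<w , w<v)
          (noncrossing (~-sym (partner-edge (page e) w)) e (partner-page′ (page e) w))
    ... | tri< u<w′ _ _ with compare (partner (page e) w) v
    ...   | tri< w′<v _ _ = u<w′ , w′<v
    ...   | tri> _ _ v<w′ = contradiction (u<w , w<v , v<w′)
            (noncrossing e (partner-edge (page e) w) (sym (partner-page (page e) w)))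
    ...   | tri≈ _ w′≡v _ = contradiction u<w (irrefl (trans
            (sym (partner-unique (page e) (~-sym e) (sym (page-unordered e (~-sym e)))))
            (trans (cong (partner (page e)) (sym w′≡v)) (partner-involutive (page e) w))))

    -- The page of `e` pairs off the vertices strictly under `e`, so their indicator can be written
    -- as `g w + g (f w)` with an involution `f`.
    parityOf-between : ∀ {u v} → u ~ v → parityOf (λ w → 𝟙 (between? u v w)) ≡ 0ℙ
    parityOf-between {u} {v} e = trans (sum-cong-≗ λ i → split (from i) (compare (from i) (f (from i))))
      (parityOf-involution f (partner-involutive c) g)
      where
      c = page e
      f = partner c
      g : V → Parity
      g w = 𝟙 (between? u v w ×-dec (w <? f w))
      I? = between? u v
      -- A matched pair inside the interval is counted at its smaller end.
      split : ∀ w → Tri (w ≺ f w) (w ≡ f w) (f w ≺ w) → 𝟙 (I? w) ≡ g w ℙ.+ g (f w)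
      split w (tri< w<fw _ fw≮w) = trans
            (𝟙-cong (I? w) (I? w ×-dec (w <? f w)) (_, w<fw) proj₁)
            (sym (trans (cong (g w ℙ.+_) (𝟙-false (I? (f w) ×-dec (f w <? f (f w)))
                          λ (_ , lt) → fw≮w (subst (f w ≺_) (partner-involutive c w) lt)))
                        (ℙ.+-identityʳ _)))
      split w (tri≈ _ w≡fw _) = contradiction (partner-edge c w) (~-irr w≡fw)
      split w (tri> w≮fw _ fw<w) = trans
            (𝟙-cong (I? w) (I? (f w) ×-dec (f w <? f (f w)))
              (λ i → partner-between e i , subst (f w ≺_) (sym (partner-involutive c w)) fw<w)
              (λ (i , _) → subst (Between u v) (partner-involutive c w) (partner-between e i)))
            (sym (cong (ℙ._+ g (f w)) (𝟙-false (I? w ×-dec (w <? f w)) (w≮fw ∘ proj₂))))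

    rankParity : V → Parity
    rankParity v = parityOf (λ w → 𝟙 (w <? v))

    -- The vertices before `v` are those before `u`, then `u` itself, then those strictly under the
    -- edge, which contribute 0.
    rankParity-< : ∀ {u v} → u ~ v → u ≺ v → rankParity v ≡ rankParity u ⁻¹
    rankParity-< {u} {v} e u<v = begin
      rankParity v
        ≡⟨ sum-cong-≗ (λ i → split (from i) (compare (from i) u)) ⟩
      parityOf (λ w → 𝟙 (w <? u) ℙ.+ (𝟙 (w ≟ u) ℙ.+ 𝟙 (between? u v w)))
        ≡⟨ ∑-distrib-+ _ (λ i → 𝟙 (from i ≟ u) ℙ.+ 𝟙 (between? u v (from i))) ⟩
      rankParity u ℙ.+ parityOf (λ w → 𝟙 (w ≟ u) ℙ.+ 𝟙 (between? u v w))
        ≡⟨ cong (rankParity u ℙ.+_) (∑-distrib-+ (λ i → 𝟙 (from i ≟ u)) _) ⟩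
      rankParity u ℙ.+ (parityOf (λ w → 𝟙 (w ≟ u)) ℙ.+ parityOf (λ w → 𝟙 (between? u v w)))
        ≡⟨ cong (rankParity u ℙ.+_) (cong₂ ℙ._+_ (parityOf-singleton u) (parityOf-between e)) ⟩
      rankParity u ℙ.+ 1ℙ
        ≡⟨ ℙ.+-comm (rankParity u) 1ℙ ⟩
      rankParity u ⁻¹ ∎
      where
      open ≡-Reasoning
      split : ∀ w → Tri (w ≺ u) (w ≡ u) (u ≺ w) →
              𝟙 (w <? v) ≡ 𝟙 (w <? u) ℙ.+ (𝟙 (w ≟ u) ℙ.+ 𝟙 (between? u v w))
      split w (tri< w<u w≢u u≮w) = trans (𝟙-true (w <? v) (<-trans w<u u<v)) (sym
            (cong₂ ℙ._+_ (𝟙-true (w <? u) w<u)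
              (cong₂ ℙ._+_ (𝟙-false (w ≟ u) w≢u) (𝟙-false (between? u v w) (u≮w ∘ proj₁)))))
      split .u (tri≈ w≮u refl u≮w) = trans (𝟙-true (u <? v) u<v) (sym
            (cong₂ ℙ._+_ (𝟙-false (u <? u) w≮u)
              (cong₂ ℙ._+_ (𝟙-true (u ≟ u) refl) (𝟙-false (between? u v u) (u≮w ∘ proj₁)))))
      split w (tri> w≮u w≢u u<w) = trans (𝟙-cong (w <? v) (between? u v w) (u<w ,_) proj₂) (sym
            (cong₂ ℙ._+_ (𝟙-false (w <? u) w≮u)
              (cong (ℙ._+ 𝟙 (between? u v w)) (𝟙-false (w ≟ u) w≢u))))

    rankParity-~ : ∀ {u v} → u ~ v → rankParity v ≡ rankParity u ⁻¹
    rankParity-~ {u} {v} e with compare u v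
    ... | tri< u<v _ _ = rankParity-< e u<v
    ... | tri≈ _ u≡v _ = contradiction e (~-irr u≡v)
    ... | tri> _ _ v<u = trans (sym (⁻¹-involutive _)) (cong _⁻¹ (sym (rankParity-< (~-sym e) v<u)))

    -- The edges `uv` and `uw` give `v` and `w` the same parity, while `vw` demands opposite ones.
    triangle-free : ∀ {u v w} → u ~ v → v ~ w → ¬ (u ~ w)
    triangle-free {u} {v} {w} uv vw uw = p≢p⁻¹ (rankParity v)
      (trans (rankParity-~ uv) (trans (sym (rankParity-~ uw)) (rankParity-~ vw)))

-- Degrees

module _ (G : Graph) where

  open Graph G

  private
    module F = Inverse finite

  ∈-vertices : ∀ v → v ∈ vertices
  ∈-vertices v = subst (_∈ vertices) (F.strictlyInverseʳ v) (∈-map⁺ F.from (∈-allFin (F.to v)))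

  -- Two duplicate-free lists with the same members are permutations of each other.
  degree-length : ∀ {v ns} → Unique ns → (∀ {w} → v ~ w ⇔ w ∈ ns) → degree v ≡ length ns
  degree-length {v} ns-unique adj = ↭-length (∼bag⇒↭
    (unique∧set⇒bag (neighbours-unique G v) ns-unique
      (mk⇔ (Equivalence.to adj ∘ proj₂ ∘ ∈-filter⁻ (v ~?_) {xs = vertices})
           (∈-filter⁺ (v ~?_) (∈-vertices _) ∘ Equivalence.from adj))))

  -- A vertex is supplied because the maximum over an empty list of degrees is 0.
  regular⇒Δ : ∀ {d} → V → (∀ v → degree v ≡ d) → Δ G ≡ d
  regular⇒Δ v regular = ℕ.≤-antisym
    (max≤v⁺ z≤n (All.map⁺ (All.universal (ℕ.≤-reflexive ∘ regular) vertices)))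
    (v≤max⁺ 0 _ (inj₂ (lose (∈-map⁺ degree (∈-vertices v)) (ℕ.≤-reflexive (sym (regular v))))))

module _ {q : ℕ} where

  Next-functional : ∀ {u v w : Fin q} → Next u v → Next u w → v ≡ w
  Next-functional (inj₁ a)       (inj₁ b)       = toℕ-injective (trans (sym a) b)
  Next-functional (inj₁ a)       (inj₂ (b , _)) = contradiction (trans (sym a) b) (ℕ.<⇒≢ (toℕ<n _))
  Next-functional (inj₂ (a , _)) (inj₁ b)       = contradiction (trans (sym b) a) (ℕ.<⇒≢ (toℕ<n _))
  Next-functional (inj₂ (_ , a)) (inj₂ (_ , b)) = toℕ-injective (trans a (sym b))

  Next-injective : ∀ {u v w : Fin q} → Next u w → Next v w → u ≡ v
  Next-injective (inj₁ a)       (inj₁ b)       = toℕ-injective (ℕ.suc-injective (trans a (sym b)))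
  Next-injective (inj₁ a)       (inj₂ (_ , b)) = contradiction (trans a b) λ ()
  Next-injective (inj₂ (_ , a)) (inj₁ b)       = contradiction (trans b a) λ ()
  Next-injective (inj₂ (a , _)) (inj₂ (b , _)) = toℕ-injective (ℕ.suc-injective (trans a (sym b)))

  -- Returning after two steps around the cycle would force `q` to be at most 2. Thus the two cyclic
  -- neighbours differ, and every link has one direction.
  Next-asym : 3 ℕ.≤ q → ∀ {u v : Fin q} → Next u v → ¬ Next v u
  Next-asym _ (inj₁ a) (inj₁ b) = contradiction (trans (cong suc a) b) (≢-sym (ℕ.<⇒≢ (ℕ.m<n⇒m<1+n ℕ.≤-refl)))
  Next-asym 3≤q (inj₁ a) (inj₂ (b , c)) = contradiction 3≤q
    (ℕ.<⇒≱ (subst (ℕ._< 3) (trans (cong suc (trans (cong suc (sym c)) a)) b) ℕ.≤-refl))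
  Next-asym 3≤q (inj₂ (a , b)) (inj₁ c) = contradiction 3≤q
    (ℕ.<⇒≱ (subst (ℕ._< 3) (trans (cong suc (trans (cong suc (sym b)) c)) a) ℕ.≤-refl))
  Next-asym 3≤q (inj₂ (a , b)) (inj₂ (c , d)) = contradiction 3≤q
    (ℕ.<⇒≱ (subst (ℕ._< 3) (trans (cong suc (sym b)) c) (s≤s (s≤s z≤n))))

successor : ∀ {q} (v : Fin q) → ∃ (Next v)
successor {suc q} v with suc (toℕ v) ℕ.<? suc q
... | yes lt  = fromℕ< lt , inj₁ (sym (toℕ-fromℕ< lt))
... | no  ¬lt = zero , inj₂ (ℕ.≤-antisym (toℕ<n v) (ℕ.≮⇒≥ ¬lt) , refl)

predecessor : ∀ {q} (v : Fin q) → ∃ λ u → Next u v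
predecessor {suc q} zero    = fromℕ q , inj₂ (cong suc (toℕ-fromℕ q) , refl)
predecessor {suc q} (suc v) = inject₁ v , inj₁ (cong suc (toℕ-inject₁ v))

module _ {p q : ℕ} (3≤q : 3 ℕ.≤ q) where

  private
    G = K (suc p) □ C q 3≤q

  degree-K□C : ∀ v → Graph.degree G v ≡ 2 + p
  degree-K□C (i , v) = trans (degree-length G unique (λ {w} → mk⇔ (sound w) (complete w)))
    (cong (2 +_) (trans (length-map _ (allFin p)) (length-tabulate _)))
    where
    open Graph G using (_~_)
    s t : Fin q
    s = proj₁ (successor v)
    t = proj₁ (predecessor v)
    v→s : Next v s
    v→s = proj₂ (successor v)
    t→v : Next t v
    t→v = proj₂ (predecessor v)
    clique : List (Fin (suc p) × Fin q)
    clique = map (λ j → punchIn i j , v) (allFin p)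
    ns : List (Fin (suc p) × Fin q)
    ns = (i , s) ∷ (i , t) ∷ clique
    clique-avoids : ∀ {w} → All.All ((i , w) ≢_) clique
    clique-avoids = All.map⁺ (All.universal (λ j eq → punchInᵢ≢i i j (sym (cong proj₁ eq))) _)
    unique : Unique ns
    unique = ((λ eq → Next-asym 3≤q v→s (subst (λ w → Next w v) (sym (cong proj₂ eq)) t→v)) ∷ clique-avoids)
           ∷ clique-avoids
           ∷ Unique.map⁺ (λ eq → punchIn-injective i _ _ (cong proj₁ eq)) (Unique.allFin⁺ p)
    sound : ∀ w → (i , v) ~ w → w ∈ ns
    sound _ (inj₁ (refl , inj₁ v→w)) = here (cong (i ,_) (Next-functional v→w v→s))
    sound _ (inj₁ (refl , inj₂ w→v)) = there (here (cong (i ,_) (Next-injective w→v t→v)))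
    sound (j , _) (inj₂ (refl , i≢j)) = there (there (subst (λ k → (k , v) ∈ clique)
      (punchIn-punchOut i≢j) (∈-map⁺ _ (∈-allFin (punchOut i≢j)))))
    complete : ∀ w → w ∈ ns → (i , v) ~ w
    complete _ (here refl)         = inj₁ (refl , inj₁ v→s)
    complete _ (there (here refl)) = inj₁ (refl , inj₂ t→v)
    complete _ (there (there w∈)) with ∈-map⁻ _ w∈
    ... | j , _ , refl = inj₂ (refl , punchInᵢ≢i i j ∘ sym)

-- The order of the vertices on the spine

-- The parity tells whether a copy is laid out in increasing or decreasing order; opposite parities
-- make the links between two copies nest.
Before : ∀ {p} → Parity → Fin p → Fin p → Set
Before 0ℙ i j = i < j
Before 1ℙ i j = j < i

module _ {p : ℕ} where

  Before-trans : ∀ b → Transitive (Before {p} b)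
  Before-trans 0ℙ i<j j<k = ℕ.<-trans i<j j<k
  Before-trans 1ℙ i>j j>k = ℕ.<-trans j>k i>j

  Before-irrefl : ∀ b {i : Fin p} → ¬ Before b i i
  Before-irrefl 0ℙ = ℕ.<-irrefl refl
  Before-irrefl 1ℙ = ℕ.<-irrefl refl

  Before-cmp : ∀ b → Trichotomous _≡_ (Before {p} b)
  Before-cmp 0ℙ i j = <-cmp i j
  Before-cmp 1ℙ i j with <-cmp i j
  ... | tri< a b c = tri> c b a
  ... | tri≈ a b c = tri≈ c b a
  ... | tri> a b c = tri< c b a

  Before-flip : ∀ b {i j : Fin p} → Before b i j → ¬ Before (b ⁻¹) i j
  Before-flip 0ℙ = ℕ.<-asym
  Before-flip 1ℙ = ℕ.<-asym

  between : ∀ b {i j k : Fin p} → Before b i k → Before b k j →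
            (i ≤ k × k ≤ j) ⊎ (j ≤ k × k ≤ i)
  between 0ℙ i<k k<j = inj₁ (ℕ.<⇒≤ i<k , ℕ.<⇒≤ k<j)
  between 1ℙ k<i j<k = inj₂ (ℕ.<⇒≤ j<k , ℕ.<⇒≤ k<i)

side : ∀ {q} → Fin q → Parity
side v = ℕ.parity (toℕ v)

module _ {p q : ℕ} where

  private
    V = Fin p × Fin q

  infix 4 _≺_
  _≺_ : V → V → Set
  (i , v) ≺ (j , w) = v < w ⊎ (v ≡ w × Before (side v) i j)

  ≺-trans : Transitive _≺_
  ≺-trans (inj₁ a) (inj₁ b)          = inj₁ (ℕ.<-trans a b)
  ≺-trans (inj₁ a) (inj₂ (refl , _)) = inj₁ a
  ≺-trans (inj₂ (refl , _)) (inj₁ b) = inj₁ b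
  ≺-trans {_ , v} (inj₂ (refl , a)) (inj₂ (refl , b)) = inj₂ (refl , Before-trans (side v) a b)

  ≺-irrefl : Irreflexive _≡_ _≺_
  ≺-irrefl {_ , v} refl (inj₁ lt)      = ℕ.<-irrefl refl lt
  ≺-irrefl {_ , v} refl (inj₂ (_ , b)) = Before-irrefl (side v) b

  ≺-cmp : Trichotomous _≡_ _≺_
  ≺-cmp (i , v) (j , w) with <-cmp v w
  ... | tri< a b c = tri< (inj₁ a) (b ∘ cong proj₂) [ c , b ∘ sym ∘ proj₁ ]′
  ... | tri> a b c = tri> [ a , b ∘ proj₁ ]′ (b ∘ cong proj₂) (inj₁ c)
  ... | tri≈ a refl c with Before-cmp (side v) i j
  ...   | tri< d e f = tri< (inj₂ (refl , d)) (e ∘ cong proj₁) [ c , f ∘ proj₂ ]′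
  ...   | tri≈ d refl f = tri≈ [ a , d ∘ proj₂ ]′ refl [ c , f ∘ proj₂ ]′
  ...   | tri> d e f = tri> [ a , d ∘ proj₂ ]′ (e ∘ cong proj₁) (inj₂ (refl , f))

  ≺⇒≤ : ∀ {i j v w} → (i , v) ≺ (j , w) → v ≤ w
  ≺⇒≤ (inj₁ lt)         = ℕ.<⇒≤ lt
  ≺⇒≤ (inj₂ (refl , _)) = ℕ.≤-refl

  ≺⇒Before : ∀ {i j v} → (i , v) ≺ (j , v) → Before (side v) i j
  ≺⇒Before (inj₁ lt)      = contradiction lt (ℕ.<-irrefl refl)
  ≺⇒Before (inj₂ (_ , b)) = b

  ≺-isStrictTotalOrder : IsStrictTotalOrder _≡_ _≺_
  ≺-isStrictTotalOrder = record
    { isStrictPartialOrder = record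
      { isEquivalence = isEquivalence
      ; irrefl        = ≺-irrefl
      ; trans         = ≺-trans
      ; <-resp-≈      = (λ { refl → λ x → x }) , (λ { refl → λ x → x })
      }
    ; compare = ≺-cmp
    }

-- Page assignments described by local conditions

-- κ v i j is the page of the edge ij in copy v; ℓ v i is the page of the link at
-- vertex i from copy v to the cyclically next copy.
record Colouring (p q k : ℕ) : Set where
  field
    κ : Fin q → Fin p → Fin p → ℕ
    ℓ : Fin q → Fin p → ℕ
    κ<k : ∀ v i j → κ v i j ℕ.< k
    ℓ<k : ∀ v i → ℓ v i ℕ.< k
    κ-comm : ∀ v i j → κ v i j ≡ κ v j i
    -- The weak inequalities let one condition exclude both crossings and shared ends.
    κ-noncrossing : ∀ v {i j k l} → i ≤ k → k ≤ j → j ≤ l → κ v i j ≡ κ v k l → i ≡ k × j ≡ l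
    -- A link at `k` leaves the copy, so it crosses every edge of the copy that spans `k`; equality
    -- covers the edges ending at `k`.
    κ≢ℓ-out : ∀ v {i j k} → i ≤ k → k ≤ j → κ v i j ≢ ℓ v k
    κ≢ℓ-in  : ∀ {v w i j k} → Next v w → i ≤ k → k ≤ j → κ w i j ≢ ℓ v k
    ℓ≢ℓ : ∀ {v w} → Next v w → ∀ i k → ℓ v i ≢ ℓ w k
    -- Links between copies of opposite direction are nested and may share a page; otherwise
    -- distinct links need distinct pages.
    ℓ-noncrossing : ∀ {v w i k} → Next v w → ℓ v i ≡ ℓ v k → i ≡ k ⊎ side w ≡ side v ⁻¹

  -- In a reversed copy the crossing is read from right to left, which exchanges the two edges and
  -- the ends of each.
  κ-noncrossing-Before : ∀ v b {i j k l} → Before b i k → Before b k j → Before b j l → κ v i j ≢ κ v k l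
  κ-noncrossing-Before v 0ℙ {i} {j} {k} {l} i<k k<j j<l eq =
    ℕ.<⇒≢ i<k (cong toℕ (proj₁ (κ-noncrossing v (ℕ.<⇒≤ i<k) (ℕ.<⇒≤ k<j) (ℕ.<⇒≤ j<l) eq)))
  κ-noncrossing-Before v 1ℙ {i} {j} {k} {l} k<i j<k l<j eq =
    ℕ.<⇒≢ l<j (cong toℕ (proj₁ (κ-noncrossing v (ℕ.<⇒≤ l<j) (ℕ.<⇒≤ j<k) (ℕ.<⇒≤ k<i)
      (trans (κ-comm v l k) (trans (sym eq) (κ-comm v i j))))))

  -- Two edges at `i` are a degenerate case of `κ-noncrossing`: the middle inequality is an equality
  -- if `i` lies between `j` and `l`, an outer one if `i` is a common left or right end.
  κ-matching : ∀ v {i j l} → i ≢ j → i ≢ l → κ v i j ≡ κ v i l → j ≡ l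
  κ-matching v {i} {j} {l} i≢j i≢l eq with <-cmp i j | <-cmp i l
  ... | tri≈ _ i≡j _ | _            = contradiction i≡j i≢j
  ... | tri< _ _ _   | tri≈ _ i≡l _ = contradiction i≡l i≢l
  ... | tri> _ _ _   | tri≈ _ i≡l _ = contradiction i≡l i≢l
  ... | tri< i<j _ _ | tri> _ _ l<i = contradiction
    (sym (proj₁ (κ-noncrossing v (ℕ.<⇒≤ l<i) ℕ.≤-refl (ℕ.<⇒≤ i<j) (trans (κ-comm v l i) (sym eq))))) i≢l
  ... | tri> _ _ j<i | tri< i<l _ _ = contradiction
    (sym (proj₁ (κ-noncrossing v (ℕ.<⇒≤ j<i) ℕ.≤-refl (ℕ.<⇒≤ i<l) (trans (κ-comm v j i) eq)))) i≢j
  ... | tri< i<j _ _ | tri< i<l _ _ with ≤-total j l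
  ...   | inj₁ j≤l = proj₂ (κ-noncrossing v (≤-refl {x = i}) (ℕ.<⇒≤ i<j) j≤l eq)
  ...   | inj₂ l≤j = sym (proj₂ (κ-noncrossing v (≤-refl {x = i}) (ℕ.<⇒≤ i<l) l≤j (sym eq)))
  κ-matching v {i} {j} {l} i≢j i≢l eq | tri> _ _ j<i | tri> _ _ l<i with ≤-total j l
  ...   | inj₁ j≤l = proj₁ (κ-noncrossing v j≤l (ℕ.<⇒≤ l<i) (≤-refl {x = i})
                       (trans (κ-comm v j i) (trans eq (κ-comm v i l))))
  ...   | inj₂ l≤j = sym (proj₁ (κ-noncrossing v l≤j (ℕ.<⇒≤ j<i) (≤-refl {x = i})
                       (trans (κ-comm v l i) (trans (sym eq) (κ-comm v i j)))))

  κ≢ℓ-out-Before : ∀ v b {i j k} → Before b i k → Before b k j → κ v i j ≢ ℓ v k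
  κ≢ℓ-out-Before v b {i} {j} ik kj eq with between b ik kj
  ... | inj₁ (i≤k , k≤j) = κ≢ℓ-out v i≤k k≤j eq
  ... | inj₂ (j≤k , k≤i) = κ≢ℓ-out v j≤k k≤i (trans (κ-comm v j i) eq)

  κ≢ℓ-in-Before : ∀ {v w} → Next v w → ∀ b {i j k} → Before b i k → Before b k j → κ w i j ≢ ℓ v k
  κ≢ℓ-in-Before {v} {w} vw b {i} {j} ik kj eq with between b ik kj
  ... | inj₁ (i≤k , k≤j) = κ≢ℓ-in vw i≤k k≤j eq
  ... | inj₂ (j≤k , k≤i) = κ≢ℓ-in vw j≤k k≤i (trans (κ-comm w j i) eq)

  κ≢ℓ-out-end : ∀ v {i j} → κ v i j ≢ ℓ v i
  κ≢ℓ-out-end v {i} {j} eq with ≤-total i j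
  ... | inj₁ i≤j = κ≢ℓ-out v (≤-refl {x = i}) i≤j eq
  ... | inj₂ j≤i = κ≢ℓ-out v j≤i (≤-refl {x = i}) (trans (κ-comm v j i) eq)

  κ≢ℓ-in-end : ∀ {v w} → Next v w → ∀ {i j} → κ w i j ≢ ℓ v i
  κ≢ℓ-in-end {w = w} vw {i} {j} eq with ≤-total i j
  ... | inj₁ i≤j = κ≢ℓ-in vw (≤-refl {x = i}) i≤j eq
  ... | inj₂ j≤i = κ≢ℓ-in vw j≤i (≤-refl {x = i}) (trans (κ-comm w j i) eq)

  ℓ-noncrossing-Before : ∀ {v w i k} → Next v w → Before (side v) i k → Before (side w) i k →
                         ℓ v i ≢ ℓ v k
  ℓ-noncrossing-Before {v} {w} {i} {k} vw bv bw eq with ℓ-noncrossing vw eq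
  ... | inj₁ refl = Before-irrefl (side v) bv
  ... | inj₂ flip = Before-flip (side v) bv (subst (λ b → Before b i k) flip bw)

-- From a page assignment to a matching book embedding

module _ {p q k : ℕ} (3≤q : 3 ℕ.≤ q) (colouring : Colouring p q k) where

  open Colouring colouring
  open Graph (K p □ C q 3≤q) using (V; _~_)

  colour : ∀ {u v} → u ~ v → ℕ
  colour {i , v} {j , w} (inj₁ (_ , inj₁ _)) = ℓ v i
  colour {i , v} {j , w} (inj₁ (_ , inj₂ _)) = ℓ w i
  colour {i , v} {j , w} (inj₂ _)            = κ v i j

  colour<k : ∀ {u v} (e : u ~ v) → colour e ℕ.< k
  colour<k {i , v} {j , w} (inj₁ (_ , inj₁ _)) = ℓ<k v i
  colour<k {i , v} {j , w} (inj₁ (_ , inj₂ _)) = ℓ<k w i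
  colour<k {i , v} {j , w} (inj₂ _)            = κ<k v i j

  colour-unordered : ∀ {u v} (e : u ~ v) (e′ : v ~ u) → colour e ≡ colour e′
  colour-unordered (inj₁ (refl , inj₁ _))  (inj₁ (_ , inj₂ _))  = refl
  colour-unordered (inj₁ (refl , inj₂ _))  (inj₁ (_ , inj₁ _))  = refl
  colour-unordered (inj₁ (_ , inj₁ a))     (inj₁ (_ , inj₁ b))  = contradiction b (Next-asym 3≤q a)
  colour-unordered (inj₁ (_ , inj₂ a))     (inj₁ (_ , inj₂ b))  = contradiction b (Next-asym 3≤q a)
  colour-unordered (inj₁ (refl , _))       (inj₂ (_ , i≢i))     = contradiction refl i≢i
  colour-unordered (inj₂ (_ , i≢i))        (inj₁ (refl , _))    = contradiction refl i≢i
  colour-unordered {i , v} {j , _} (inj₂ (refl , _)) (inj₂ _)   = κ-comm v i j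

  colour-matching : ∀ {u v w} (e : u ~ v) (f : u ~ w) → colour e ≡ colour f → v ≡ w
  colour-matching (inj₁ (refl , inj₁ a)) (inj₁ (refl , inj₁ b)) _  = cong (_ ,_) (Next-functional a b)
  colour-matching (inj₁ (refl , inj₂ a)) (inj₁ (refl , inj₂ b)) _  = cong (_ ,_) (Next-injective a b)
  colour-matching (inj₁ (refl , inj₁ _)) (inj₁ (refl , inj₂ b)) eq = contradiction (sym eq) (ℓ≢ℓ b _ _)
  colour-matching (inj₁ (refl , inj₂ a)) (inj₁ (refl , inj₁ _)) eq = contradiction eq (ℓ≢ℓ a _ _)
  colour-matching (inj₁ (refl , inj₁ _)) (inj₂ (refl , _))      eq = contradiction (sym eq) (κ≢ℓ-out-end _)
  colour-matching (inj₁ (refl , inj₂ a)) (inj₂ (refl , _))      eq = contradiction (sym eq) (κ≢ℓ-in-end a)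
  colour-matching (inj₂ (refl , _))      (inj₁ (refl , inj₁ _)) eq = contradiction eq (κ≢ℓ-out-end _)
  colour-matching (inj₂ (refl , _))      (inj₁ (refl , inj₂ b)) eq = contradiction eq (κ≢ℓ-in-end b)
  colour-matching (inj₂ (refl , n))      (inj₂ (refl , n′))     eq = cong (_, _) (κ-matching _ n n′ eq)

  -- The edges directed along the spine, with their pages; the closing link of copy z
  -- to copy o = 0 thereby runs backwards.
  data Ascending : V → V → ℕ → Set where
    flat : ∀ {v i j} → Ascending (i , v) (j , v) (κ v i j)
    step : ∀ {v w i} → suc (toℕ v) ≡ toℕ w → Ascending (i , v) (i , w) (ℓ v i)
    wrap : ∀ {o z i} → suc (toℕ z) ≡ q → toℕ o ≡ 0 → Ascending (i , o) (i , z) (ℓ z i)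

  ascending : ∀ {u v} (e : u ~ v) → u ≺ v → Ascending u v (colour e)
  ascending (inj₂ (refl , _)) _                           = flat
  ascending (inj₁ (refl , inj₁ (inj₁ a))) _               = step a
  ascending (inj₁ (refl , inj₂ (inj₂ (a , b)))) _         = wrap a b
  -- The last two clauses are links traversed down the spine.
  ascending (inj₁ (refl , inj₁ (inj₂ (a , b)))) u≺v       = contradiction (≺⇒≤ u≺v)
    (ℕ.<⇒≱ (subst (ℕ._< _) (sym b) (ℕ.s≤s⁻¹ (ℕ.≤-trans (ℕ.m+n≤o⇒n≤o 1 3≤q) (ℕ.≤-reflexive (sym a))))))
  ascending (inj₁ (refl , inj₂ (inj₁ a))) u≺v             =
    contradiction (≺⇒≤ u≺v) (ℕ.<⇒≱ (ℕ.≤-reflexive a))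

  level : ∀ {v w : Fin q} → v ≤ w → w ≤ v → v ≡ w
  level v≤w w≤v = toℕ-injective (ℕ.≤-antisym v≤w w≤v)

  bottom : ∀ {v w : Fin q} → v ≤ w → toℕ w ≡ 0 → v ≡ w
  bottom v≤w w≡0 = level v≤w (subst (ℕ._≤ _) (sym w≡0) z≤n)

  top : ∀ {v w : Fin q} → v ≤ w → suc (toℕ v) ≡ q → v ≡ w
  top {v} {w} v≤w 1+v≡q = level v≤w (ℕ.s≤s⁻¹ (ℕ.≤-trans (toℕ<n w) (ℕ.≤-reflexive (sym 1+v≡q))))

  -- The order of the four ends forces some of their copies to coincide, and each case then
  -- contradicts one condition of `Colouring`.
  colour-noncrossing : ∀ {u v x y c d} → Ascending u v c → Ascending x y d → c ≡ d →
                       u ≺ x → x ≺ v → ¬ (v ≺ y)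
  colour-noncrossing (flat {v}) (flat {w}) eq ux xv vy with refl ← level (≺⇒≤ ux) (≺⇒≤ xv) =
    κ-noncrossing-Before v (side v) (≺⇒Before ux) (≺⇒Before xv) (≺⇒Before vy) eq
  colour-noncrossing (flat {v}) (step _) eq ux xv vy with refl ← level (≺⇒≤ ux) (≺⇒≤ xv) =
    κ≢ℓ-out-Before v (side v) (≺⇒Before ux) (≺⇒Before xv) eq
  colour-noncrossing (flat {v}) (wrap z o) eq ux xv vy with refl ← level (≺⇒≤ ux) (≺⇒≤ xv) =
    κ≢ℓ-in-Before (inj₂ (z , o)) (side v) (≺⇒Before ux) (≺⇒Before xv) eq
  colour-noncrossing (step {w = w} a) flat eq ux xv vy with refl ← level (≺⇒≤ xv) (≺⇒≤ vy) =
    κ≢ℓ-in-Before (inj₁ a) (side w) (≺⇒Before xv) (≺⇒Before vy) (sym eq)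
  colour-noncrossing (step {v} {w} a) (step {x} {y} b) eq ux xv vy with ℕ.m≤n⇒m<n∨m≡n (≺⇒≤ ux)
  -- Here one link ends in the copy where the other begins; in the next case both links join the
  -- same two copies.
  ... | inj₁ v<x with refl ← level (≺⇒≤ xv) (subst (ℕ._≤ toℕ x) a v<x) = ℓ≢ℓ (inj₁ a) _ _ eq
  ... | inj₂ v≡x with refl ← toℕ-injective v≡x with refl ← toℕ-injective (trans (sym a) b) =
    ℓ-noncrossing-Before (inj₁ a) (≺⇒Before ux) (≺⇒Before vy) eq
  -- The first link must leave copy 0, which is the copy that the closing link enters.
  colour-noncrossing (step a) (wrap z o) eq ux xv vy with refl ← bottom (≺⇒≤ ux) o =
    ℓ≢ℓ (inj₂ (z , o)) _ _ (sym eq)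
  colour-noncrossing (wrap {z = v} z o) flat eq ux xv vy with refl ← top (≺⇒≤ vy) z =
    κ≢ℓ-out-Before v (side v) (≺⇒Before xv) (≺⇒Before vy) (sym eq)
  colour-noncrossing (wrap z o) (step a) eq ux xv vy with refl ← top (≺⇒≤ vy) z =
    ℓ≢ℓ (inj₁ a) _ _ (sym eq)
  colour-noncrossing (wrap z o) (wrap z′ o′) eq ux xv vy
    with refl ← bottom (≺⇒≤ ux) o′ | refl ← top (≺⇒≤ vy) z =
    ℓ-noncrossing-Before (inj₂ (z , o)) (≺⇒Before vy) (≺⇒Before ux) eq

  page-injective : ∀ {u v x y} (e : u ~ v) (f : x ~ y) →
                   fromℕ< (colour<k e) ≡ fromℕ< (colour<k f) → colour e ≡ colour f
  page-injective e f = fromℕ<-injective _ _ (colour<k e) (colour<k f)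

  embedding : MatchingBookEmbedding (K p □ C q 3≤q) k
  embedding = record
    { _<_                = _≺_
    ; isStrictTotalOrder = ≺-isStrictTotalOrder
    ; page               = λ e → fromℕ< (colour<k e)
    ; page-unordered     = λ e e′ → fromℕ<-cong _ _ (colour-unordered e e′) (colour<k e) (colour<k e′)
    ; noncrossing        = λ e f eq (ux , xv , vy) → colour-noncrossing
        (ascending e (≺-trans ux xv)) (ascending f (≺-trans xv vy)) (page-injective e f eq) ux xv vy
    } , λ e f eq → colour-matching e f (page-injective e f eq)


-- Drawing a complete graph

-- With equal remainders, a larger quotient puts `b` at `a + n` or beyond, and any other quotient
-- puts it at or below `a`.
%-distinct : ∀ {a b n} .{{_ : NonZero n}} → a ℕ.< b → b ℕ.< a + n → a % n ≢ b % n
%-distinct {a} {b} {n} a<b b<a+n eq with (a / n) ℕ.<? (b / n)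
... | yes q<q′ = ℕ.<⇒≱ b<a+n (begin
    a + n                        ≡⟨ cong (_+ n) (m≡m%n+[m/n]*n a n) ⟩
    a % n + a / n * n + n        ≡⟨ ℕ.+-assoc (a % n) _ n ⟩
    a % n + (a / n * n + n)      ≡⟨ cong (a % n +_) (ℕ.+-comm _ n) ⟩
    a % n + suc (a / n) * n      ≤⟨ ℕ.+-monoʳ-≤ (a % n) (ℕ.*-monoˡ-≤ n q<q′) ⟩
    a % n + b / n * n            ≡⟨ cong (_+ b / n * n) eq ⟩
    b % n + b / n * n            ≡⟨ m≡m%n+[m/n]*n b n ⟨
    b                            ∎)
  where open ℕ.≤-Reasoning
... | no q≮q′ = ℕ.<⇒≱ a<b (begin
    b                            ≡⟨ m≡m%n+[m/n]*n b n ⟩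
    b % n + b / n * n            ≡⟨ cong (_+ b / n * n) eq ⟨
    a % n + b / n * n            ≤⟨ ℕ.+-monoʳ-≤ (a % n) (ℕ.*-monoˡ-≤ n (ℕ.≮⇒≥ q≮q′)) ⟩
    a % n + a / n * n            ≡⟨ m≡m%n+[m/n]*n a n ⟨
    a                            ∎)
  where open ℕ.≤-Reasoning

-- The pages are classes of parallel chords of a regular `n`-gon. The inequalities give
-- `i + j ≤ k + l < i + j + n`, so congruent sums are equal and both outer inequalities are tight.
chord-noncrossing : ∀ {p} n .{{_ : NonZero n}} → p ℕ.≤ n → ∀ s {i j k l : Fin p} →
  i ≤ k → k ≤ j → j ≤ l →
  (s + (toℕ i + toℕ j)) % n ≡ (s + (toℕ k + toℕ l)) % n → i ≡ k × j ≡ l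
chord-noncrossing {p} n p≤n s {i} {j} {k} {l} i≤k k≤j j≤l eq =
  toℕ-injective (ℕ.≤-antisym i≤k (ℕ.≮⇒≥ λ i<k → i+j≮k+l (ℕ.+-mono-<-≤ i<k j≤l))) ,
  toℕ-injective (ℕ.≤-antisym j≤l (ℕ.≮⇒≥ λ j<l → i+j≮k+l (ℕ.+-mono-≤-< i≤k j<l)))
  where
  open ℕ.≤-Reasoning
  i+j≮k+l : ¬ (toℕ i + toℕ j ℕ.< toℕ k + toℕ l)
  i+j≮k+l lt = %-distinct (ℕ.+-monoʳ-< s lt) (begin-strict
    s + (toℕ k + toℕ l)         <⟨ ℕ.+-monoʳ-< s (ℕ.+-mono-≤-< k≤j (ℕ.≤-trans (toℕ<n l) p≤n)) ⟩
    s + (toℕ j + n)             ≤⟨ ℕ.+-monoʳ-≤ s (ℕ.+-monoˡ-≤ n (ℕ.m≤n+m (toℕ j) (toℕ i))) ⟩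
    s + (toℕ i + toℕ j + n)     ≡⟨ ℕ.+-assoc s _ n ⟨
    s + (toℕ i + toℕ j) + n     ∎) eq

-- The added vertex p is joined to k on page 1 + k + p ≡ k.
chord-exposed : ∀ {p} {i j k : Fin p} → i ≤ k → k ≤ j →
                (1 + (toℕ i + toℕ j)) % suc p ≢ toℕ k
-- The representative `k + suc p` of `k` exceeds `1 + i + j` by less than `suc p`.
chord-exposed {p} {i} {j} {k} i≤k k≤j eq = %-distinct
  (begin-strict
    1 + (toℕ i + toℕ j)          ≡⟨ ℕ.+-suc (toℕ i) (toℕ j) ⟨
    toℕ i + suc (toℕ j)          <⟨ ℕ.+-mono-≤-< i≤k (s≤s (toℕ<n j)) ⟩
    toℕ k + suc p                ∎)
  (begin-strict
    toℕ k + suc p                <⟨ ℕ.+-monoˡ-< (suc p) (s≤s (ℕ.≤-trans k≤j (ℕ.m≤n+m (toℕ j) (toℕ i)))) ⟩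
    1 + (toℕ i + toℕ j) + suc p  ∎)
  (begin-equality
    (1 + (toℕ i + toℕ j)) % suc p ≡⟨ eq ⟩
    toℕ k                         ≡⟨ m<n⇒m%n≡m (ℕ.m<n⇒m<1+n (toℕ<n k)) ⟨
    toℕ k % suc p                 ≡⟨ [m+n]%n≡m%n (toℕ k) (suc p) ⟨
    (toℕ k + suc p) % suc p       ∎)
  where open ℕ.≤-Reasoning

-- Link pages and the assignment for even q

parity-suc : ∀ n → ℕ.parity (suc n) ≡ ℕ.parity n ⁻¹
parity-suc n = trans (sym (⁻¹-involutive _)) (cong _⁻¹ (suc-homo-⁻¹ n))

-- The argument is the parity of the copy that the link leaves.
linkPage : ℕ → Parity → ℕ
linkPage p 0ℙ = suc p
linkPage p 1ℙ = p

p≤linkPage : ∀ p b → p ℕ.≤ linkPage p b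
p≤linkPage p 0ℙ = ℕ.n≤1+n p
p≤linkPage p 1ℙ = ℕ.≤-refl

linkPage< : ∀ p b → linkPage p b ℕ.< 2 + p
linkPage< p 0ℙ = ℕ.≤-refl
linkPage< p 1ℙ = ℕ.m<n⇒m<1+n ℕ.≤-refl

linkPage-flip : ∀ p b → linkPage p b ≢ linkPage p (b ⁻¹)
linkPage-flip p 0ℙ = ℕ.1+n≢n
linkPage-flip p 1ℙ = ≢-sym ℕ.1+n≢n

-- For even `q` the direction alternates all the way around the cycle, so all links nest on pages
-- `p` and `suc p`, above the pages of the cliques.
evenColouring : ∀ p q .{{_ : NonZero p}} → ℕ.parity q ≡ 0ℙ → Colouring p q (2 + p)
evenColouring p q q-even = record
  { κ              = κ
  ; ℓ              = ℓ
  ; κ<k            = λ v i j → ℕ.m<n⇒m<1+n (ℕ.m<n⇒m<1+n (κ<p v i j))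
  ; ℓ<k            = λ v _ → linkPage< p (side v)
  ; κ-comm         = λ _ i j → cong (_% p) (ℕ.+-comm (toℕ i) (toℕ j))
  ; κ-noncrossing  = λ _ → chord-noncrossing p ℕ.≤-refl 0
  ; κ≢ℓ-out        = λ v {i} {j} {k} _ _ → κ≢ℓ v v i j k
  ; κ≢ℓ-in         = λ {v} {w} {i} {j} {k} _ _ _ → κ≢ℓ w v i j k
  ; ℓ≢ℓ            = λ {v} vw _ _ eq →
      linkPage-flip p (side v) (trans eq (cong (linkPage p) (flip vw)))
  ; ℓ-noncrossing  = λ vw _ → inj₂ (flip vw)
  }
  where
  κ : Fin q → Fin p → Fin p → ℕ
  κ _ i j = (toℕ i + toℕ j) % p
  ℓ : Fin q → Fin p → ℕ
  ℓ v _ = linkPage p (side v)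
  κ<p : ∀ v i j → κ v i j ℕ.< p
  κ<p _ i j = m%n<n (toℕ i + toℕ j) p
  κ≢ℓ : ∀ v w i j k → κ v i j ≢ ℓ w k
  κ≢ℓ v w i j k = ℕ.<⇒≢ (ℕ.<-≤-trans (κ<p v i j) (p≤linkPage p (side w)))
  flip : ∀ {v w} → Next v w → side w ≡ side v ⁻¹
  flip {v} (inj₁ 1+v≡w) = trans (cong ℕ.parity (sym 1+v≡w)) (parity-suc (toℕ v))
  flip {v} (inj₂ (1+v≡q , w≡0)) = trans (cong ℕ.parity w≡0)
    (trans (sym q-even) (trans (cong ℕ.parity (sym 1+v≡q)) (parity-suc (toℕ v))))

-- The assignment for odd q

-- In the last copy, page p is taken by the links from the copy before it, but page
-- p+1 is free.
recolour : ℕ → ℕ → ℕ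
recolour p c with c ℕ.≟ p
... | yes _ = suc p
... | no  _ = c

recolour≢ : ∀ p c → recolour p c ≢ p
recolour≢ p c with c ℕ.≟ p
... | yes _   = ℕ.1+n≢n
... | no  c≢p = c≢p

recolour< : ∀ p {c} → c ℕ.< suc p → recolour p c ℕ.< 2 + p
recolour< p {c} c<1+p with c ℕ.≟ p
... | yes _ = ℕ.≤-refl
... | no  _ = ℕ.m<n⇒m<1+n c<1+p

-- Only page `p` is moved, and it moves to `suc p`; the pages below `p`, which the closing links
-- use, keep their edges.
recolour-reflects : ∀ p c {d} → d ℕ.< p → recolour p c ≡ d → c ≡ d
recolour-reflects p c d<p eq with c ℕ.≟ p
... | yes _ = contradiction (sym eq) (ℕ.<⇒≢ (ℕ.m<n⇒m<1+n d<p))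
... | no  _ = eq

recolour-injective : ∀ p {c d} → c ℕ.< suc p → d ℕ.< suc p → recolour p c ≡ recolour p d → c ≡ d
recolour-injective p {c} {d} c< d< eq with c ℕ.≟ p | d ℕ.≟ p
... | yes c≡p | yes d≡p = trans c≡p (sym d≡p)
... | yes _   | no _    = contradiction (sym eq) (ℕ.<⇒≢ d<)
... | no _    | yes _   = contradiction eq (ℕ.<⇒≢ c<)
... | no _    | no _    = eq

module _ {q : ℕ} where

  -- The two copies joined by closing links are singled out; the inequalities make the cases
  -- exclusive.
  data Place (v : Fin q) : Set where
    last   : suc (toℕ v) ≡ q → Place v
    first  : suc (toℕ v) ≢ q → toℕ v ≡ 0 → Place v
    middle : suc (toℕ v) ≢ q → toℕ v ≢ 0 → Place v

  place : ∀ v → Place v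
  place v with suc (toℕ v) ℕ.≟ q | toℕ v ℕ.≟ 0
  ... | yes a | _     = last a
  ... | no a  | yes b = first a b
  ... | no a  | no b  = middle a b

module _ (p q : ℕ) .{{_ : NonZero p}} (1<q : 1 ℕ.< q) (q-odd : ℕ.parity q ≡ 1ℙ) where

  private

    κ : ∀ {v : Fin q} → Place v → Fin p → Fin p → ℕ
    κ (last _)     i j = recolour p ((1 + (toℕ i + toℕ j)) % suc p)
    κ (first _ _)  i j = (1 + (toℕ i + toℕ j)) % suc p
    κ (middle _ _) i j = (toℕ i + toℕ j) % p

    ℓ : ∀ {v : Fin q} → Place v → Fin p → ℕ
    ℓ (last _)         i = toℕ i
    ℓ {v} (first _ _)  _ = linkPage p (side v)
    ℓ {v} (middle _ _) _ = linkPage p (side v)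

    ℓ-notLast : ∀ {v} (a : Place v) → suc (toℕ v) ≢ q → ∀ i → ℓ a i ≡ linkPage p (side v)
    ℓ-notLast (last e)     n _ = contradiction e n
    ℓ-notLast (first _ _)  _ _ = refl
    ℓ-notLast (middle _ _) _ _ = refl

    first-not-last : ∀ {v : Fin q} → toℕ v ≡ 0 → suc (toℕ v) ≢ q
    first-not-last v≡0 1+v≡q = ℕ.<⇒≢ 1<q (trans (cong suc (sym v≡0)) 1+v≡q)

    flip : ∀ {v w} → Next v w → suc (toℕ v) ≢ q → side w ≡ side v ⁻¹
    flip {v} (inj₁ 1+v≡w) _ = trans (cong ℕ.parity (sym 1+v≡w)) (parity-suc (toℕ v))
    flip (inj₂ (e , _))   n = contradiction e n

    Next-last : ∀ {v w : Fin q} → Next v w → suc (toℕ v) ≡ q → toℕ w ≡ 0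
    Next-last {w = w} (inj₁ a) e = contradiction (trans (sym a) e) (ℕ.<⇒≢ (toℕ<n w))
    Next-last (inj₂ (_ , w≡0)) _ = w≡0

    Next-first : ∀ {v w : Fin q} → Next v w → toℕ w ≡ 0 → suc (toℕ v) ≡ q
    Next-first (inj₁ a) w≡0       = contradiction (trans a w≡0) λ ()
    Next-first (inj₂ (e , _)) _   = e

    middle≢link : ∀ (i j : Fin p) b → (toℕ i + toℕ j) % p ≢ linkPage p b
    middle≢link i j b = ℕ.<⇒≢ (ℕ.<-≤-trans (m%n<n (toℕ i + toℕ j) p) (p≤linkPage p b))

    closing≢link : ∀ (i : Fin p) b → toℕ i ≢ linkPage p b
    closing≢link i b = ℕ.<⇒≢ (ℕ.<-≤-trans (toℕ<n i) (p≤linkPage p b))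

    rot< : ∀ (i j : Fin p) → (1 + (toℕ i + toℕ j)) % suc p ℕ.< suc p
    rot< i j = m%n<n (1 + (toℕ i + toℕ j)) (suc p)

    κ< : ∀ {v} (a : Place v) i j → κ a i j ℕ.< 2 + p
    κ< (last _)     i j = recolour< p (rot< i j)
    κ< (first _ _)  i j = ℕ.m<n⇒m<1+n (rot< i j)
    κ< (middle _ _) i j = ℕ.m<n⇒m<1+n (ℕ.m<n⇒m<1+n (m%n<n (toℕ i + toℕ j) p))

    ℓ< : ∀ {v} (a : Place v) i → ℓ a i ℕ.< 2 + p
    ℓ< (last _) i         = ℕ.m<n⇒m<1+n (ℕ.m<n⇒m<1+n (toℕ<n i))
    ℓ< {v} (first _ _) _  = linkPage< p (side v)
    ℓ< {v} (middle _ _) _ = linkPage< p (side v)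

    κ-comm : ∀ {v} (a : Place v) i j → κ a i j ≡ κ a j i
    κ-comm (last _)     i j = cong (λ s → recolour p ((1 + s) % suc p)) (ℕ.+-comm (toℕ i) (toℕ j))
    κ-comm (first _ _)  i j = cong (λ s → (1 + s) % suc p) (ℕ.+-comm (toℕ i) (toℕ j))
    κ-comm (middle _ _) i j = cong (_% p) (ℕ.+-comm (toℕ i) (toℕ j))

    κ-noncrossing : ∀ {v} (a : Place v) {i j k l} → i ≤ k → k ≤ j → j ≤ l →
                    κ a i j ≡ κ a k l → i ≡ k × j ≡ l
    κ-noncrossing (last _) {i} {j} {k} {l} ik kj jl eq = chord-noncrossing (suc p) (ℕ.n≤1+n p) 1 ik kj jl
      (recolour-injective p (rot< i j) (rot< k l) eq)
    κ-noncrossing (first _ _)  = chord-noncrossing (suc p) (ℕ.n≤1+n p) 1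
    κ-noncrossing (middle _ _) = chord-noncrossing p ℕ.≤-refl 0

    κ≢ℓ-out : ∀ {v} (a : Place v) {i j k} → i ≤ k → k ≤ j → κ a i j ≢ ℓ a k
    κ≢ℓ-out (last _) {k = k} ik kj eq = chord-exposed ik kj (recolour-reflects p _ (toℕ<n k) eq)
    -- Copy 0 is even, so its outgoing links are on page `suc p`, while its clique uses pages up to
    -- `p`.
    κ≢ℓ-out {v} (first _ v≡0) {i} {j} ik kj eq = ℕ.<⇒≢ (rot< i j)
      (trans eq (cong (linkPage p ∘ ℕ.parity) v≡0))
    κ≢ℓ-out {v} (middle _ _) {i} {j} _ _ = middle≢link i j (side v)

    κ≢ℓ-in : ∀ {v w} (a : Place v) (b : Place w) {i j k} → Next v w → i ≤ k → k ≤ j → κ b i j ≢ ℓ a k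
    -- As `q` is odd, the copy before the last has odd index, so its links are on page `p`, which
    -- `recolour` vacates.
    κ≢ℓ-in {v} {w} a (last e) {i} {j} {k} vw ik kj eq =
      recolour≢ p ((1 + (toℕ i + toℕ j)) % suc p) (trans eq (trans (ℓ-notLast a v-not-last k) (cong (linkPage p) v-odd)))
      where
      v-not-last : suc (toℕ v) ≢ q
      v-not-last e′ = first-not-last (Next-last vw e′) e
      v-odd : side v ≡ 1ℙ
      v-odd = trans (sym (⁻¹-involutive _)) (trans (cong _⁻¹ (sym (flip vw v-not-last)))
        (trans (sym (parity-suc (toℕ w))) (trans (cong ℕ.parity e) q-odd)))
    -- Seen from copy 0 as well, the closing links act as the edges to the added vertex.
    κ≢ℓ-in (last _) (first _ _) _ ik kj = chord-exposed ik kj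
    κ≢ℓ-in (first n _)  (first _ w≡0) vw = contradiction (Next-first vw w≡0) n
    κ≢ℓ-in (middle n _) (first _ w≡0) vw = contradiction (Next-first vw w≡0) n
    κ≢ℓ-in (last e) (middle _ w≢0) vw    = contradiction (Next-last vw e) w≢0
    κ≢ℓ-in {v} (first _ _)  (middle _ _) {i} {j} _ _ _ = middle≢link i j (side v)
    κ≢ℓ-in {v} (middle _ _) (middle _ _) {i} {j} _ _ _ = middle≢link i j (side v)

    links-differ : ∀ {v w} (a : Place v) (b : Place w) → Next v w → suc (toℕ v) ≢ q → suc (toℕ w) ≢ q →
                   ∀ i k → ℓ a i ≢ ℓ b k
    links-differ {v} a b vw m n i k eq = linkPage-flip p (side v) (trans (sym (ℓ-notLast a m i))
      (trans eq (trans (ℓ-notLast b n k) (cong (linkPage p) (flip vw m)))))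

    ℓ≢ℓ : ∀ {v w} (a : Place v) (b : Place w) → Next v w → ∀ i k → ℓ a i ≢ ℓ b k
    ℓ≢ℓ (last e) (last e′)             vw = contradiction e′ (first-not-last (Next-last vw e))
    -- Closing links stay below page `p`, all other links are on `p` or `suc p`.
    ℓ≢ℓ (last _) (first _ _ )       _  = λ i _ → closing≢link i _
    ℓ≢ℓ (last _) (middle _ _)          _  = λ i _ → closing≢link i _
    ℓ≢ℓ (first _ _) (last _)           _  = λ _ k → ≢-sym (closing≢link k _)
    ℓ≢ℓ (middle _ _) (last _)          _  = λ _ k → ≢-sym (closing≢link k _)
    ℓ≢ℓ a@(first m _)  b@(first n _)   vw = links-differ a b vw m n
    ℓ≢ℓ a@(first m _)  b@(middle n _)  vw = links-differ a b vw m n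
    ℓ≢ℓ a@(middle m _) b@(first n _)   vw = links-differ a b vw m n
    ℓ≢ℓ a@(middle m _) b@(middle n _)  vw = links-differ a b vw m n

    ℓ-noncrossing : ∀ {v w} (a : Place v) {i k} → Next v w → ℓ a i ≡ ℓ a k → i ≡ k ⊎ side w ≡ side v ⁻¹
    -- The last copy and copy 0 have the same direction, so the closing links do not nest; each has
    -- a page of its own.
    ℓ-noncrossing (last _)     _  eq = inj₁ (toℕ-injective eq)
    ℓ-noncrossing (first n _)  vw _  = inj₂ (flip vw n)
    ℓ-noncrossing (middle n _) vw _  = inj₂ (flip vw n)

  oddColouring : Colouring p q (2 + p)
  oddColouring = record
    { κ             = λ v → κ (place v)
    ; ℓ             = λ v → ℓ (place v)
    ; κ<k           = λ v → κ< (place v)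
    ; ℓ<k           = λ v → ℓ< (place v)
    ; κ-comm        = λ v → κ-comm (place v)
    ; κ-noncrossing = λ v → κ-noncrossing (place v)
    ; κ≢ℓ-out       = λ v → κ≢ℓ-out (place v)
    ; κ≢ℓ-in        = κ≢ℓ-in (place _) (place _)
    ; ℓ≢ℓ           = ℓ≢ℓ (place _) (place _)
    ; ℓ-noncrossing = ℓ-noncrossing (place _)
    }

-- The two bounds combined

colouring : ∀ p q .{{_ : NonZero p}} → 1 ℕ.< q → Colouring p q (2 + p)
colouring p q 1<q with ℕ.parity q in eq
... | 0ℙ = evenColouring p q eq
... | 1ℙ = oddColouring p q 1<q eq

mainTheorem1 : (p q : ℕ) → 3 ℕ.≤ p → (3≤q : 3 ℕ.≤ q) →
    mbt (K p □ C q 3≤q) ≔ (Δ (K p □ C q 3≤q) + 1)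
mainTheorem1 p@(suc p′@(suc (suc _))) q@(suc _) (s≤s (s≤s (s≤s _))) 3≤q
  -- With `p = suc p′` every degree is `2 + p′`, so the claimed number of pages becomes `2 + p`.
  rewrite regular⇒Δ (K p □ C q 3≤q) (zero , zero) (degree-K□C 3≤q) | ℕ.+-comm p′ 1 =
    embedding 3≤q (colouring p q (ℕ.≤-trans (s≤s (s≤s z≤n)) 3≤q)) ,
    -- Fewer than `2 + p` pages are at most the degree of every vertex, which excludes the triangle
    -- on vertices 0, 1, 2 of copy 0.
    λ j (E , matching) → ℕ.≮⇒≥ λ j<2+p → triangle-free G E matching
      (λ v → ℕ.≤-trans (ℕ.s≤s⁻¹ j<2+p) (ℕ.≤-reflexive (sym (degree-K□C 3≤q v))))
      {zero , zero} {suc zero , zero} {suc (suc zero) , zero}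
      (inj₂ (refl , λ ())) (inj₂ (refl , λ ())) (inj₂ (refl , λ ()))
  where G = K p □ C q 3≤q
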